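{- Let $\Gamma$ be a strongly regular graph with $\Gamma_2\cong\Gamma$. Then $\Gamma$ is self-complementary and has parameters $(v,k,\lambda,\mu)=(4t+1,2t,t-1,t)$ for some positive integer $t$, and the number of vertices $4t+1$ is a sum of two squares.
   Context: For a finite simple graph $\Gamma$ with path-distance $d$, $\Gamma_2$ is the graph on $V(\Gamma)$ with $u,v$ adjacent iff $d(u,v)=2$. A graph on $v$ vertices is strongly regular with parameters $(v,k,\lambda,\mu)$ if it is $k$-regular, every two adjacent vertices have exactly $\lambda$ common neighbours and every two distinct non-adjacent vertices have exactly $\mu$ common neighbours; as is standard, a strongly regular graph is assumed to be neither complete nor edgeless. -}

module Defs where

open import Data.Nat using (ℕ; zero; suc; _+_; _*_; _∸_; _≤_)
open import Data.Fin using (Fin)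
open import Data.Bool using (Bool; true; false; not; _∧_)
open import Data.List using (List; length; filter; allFin)
open import Data.Product using (Σ; ∃; _×_; _,_)
open import Relation.Binary.PropositionalEquality using (_≡_; _≢_)
open import Relation.Nullary using (¬_)
open import Function.Bundles using (_↔_; _⇔_; Inverse)
open import Relation.Unary using (Pred)
open import Data.Bool.Properties using (T?)
open import Data.Fin using (_≟_)
open import Relation.Nullary.Decidable using (⌊_⌋)

record Graph (n : ℕ) : Set where
  field
    adj   : Fin n → Fin n → Bool
    sym   : ∀ u v → adj u v ≡ adj v u
    irrefl : ∀ u → adj u u ≡ false
open Graph public

count : {n : ℕ} → (Fin n → Bool) → ℕ
count {n} p = length (filter (λ w → T? (p w)) (allFin n))

degree : {n : ℕ} → Graph n → Fin n → ℕ
degree G u = count (λ w → adj G u w)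

commonNbrs : {n : ℕ} → Graph n → Fin n → Fin n → ℕ
commonNbrs G u v = count (λ w → adj G u w ∧ adj G v w)

record IsSRG {n : ℕ} (G : Graph n) (k lam mu : ℕ) : Set where
  field
    regular   : ∀ u → degree G u ≡ k
    adjCommon : ∀ u v → adj G u v ≡ true → commonNbrs G u v ≡ lam
    nonCommon : ∀ u v → u ≢ v → adj G u v ≡ false → commonNbrs G u v ≡ mu
    notEdgeless : Σ (Fin n) λ u → Σ (Fin n) λ v → adj G u v ≡ true
    notComplete : Σ (Fin n) λ u → Σ (Fin n) λ v → (u ≢ v) × (adj G u v ≡ false)

dist2 : {n : ℕ} → Graph n → Fin n → Fin n → Set
dist2 {n} G u v = (u ≢ v) × (adj G u v ≡ false) ×
  Σ (Fin n) λ w → (adj G u w ≡ true) × (adj G w v ≡ true)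

Dist2IsoSelf : {n : ℕ} → Graph n → Set
Dist2IsoSelf {n} G = Σ (Fin n ↔ Fin n) λ σ → ∀ u v →
  (adj G (Inverse.to σ u) (Inverse.to σ v) ≡ true) ⇔ dist2 G u v

SelfComplementary : {n : ℕ} → Graph n → Set
SelfComplementary {n} G = Σ (Fin n ↔ Fin n) λ σ → ∀ u v →
  (adj G (Inverse.to σ u) (Inverse.to σ v) ≡ true) ⇔ ((u ≢ v) × (adj G u v ≡ false))

{-# OPTIONS --safe #-}
module Submission where

-- If μ = 0 no two vertices are at distance 2, so μ > 0, distance 2 is
-- non-adjacency and Γ is self-complementary. The complementing permutation negates
-- the Seidel matrix S; hence S has zero row sums and S Sᵀ has a single off-diagonal
-- value, which the row sums force to be −1. This gives S Sᵀ = nI − J and the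
-- parameters. Bordering S yields an integral matrix C of order n + 1 = 4t + 2 with
-- Cᵀ C = nI. There is also an integral H of order 2ⁿ with Hᵀ H = nI. As 2t + 1 is
-- odd, suitably many copies of C have total order ≡ 2 (mod 2ⁿ), and Witt
-- cancellation against copies of H leaves n(x² + y²) rationally equivalent to
-- x² + y². So n is a sum of two rational, hence of two integral, squares.

open import Defs hiding (sym)
open import Data.Bool using (Bool; true; false; _∧_)
import Data.Bool.Properties as Bool
open import Data.Fin using (Fin; zero; suc)
open import Data.Fin.Properties using (any?; _≟_)
open import Data.Integer using (ℤ; +_; -[1+_]; _+_; _*_; _-_; -_; 0ℤ; 1ℤ; -1ℤ; ∣_∣)
open import Data.Integer.DivMod using (_/ℕ_; _%ℕ_; a≡a%ℕn+[a/ℕn]*n; n%ℕd<d)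
import Data.Integer.Properties as ℤ
open import Data.Integer.Tactic.RingSolver using (solve-∀)
import Data.List as List
open import Data.List.Membership.Propositional.Properties using (∈-filter⁺; ∈-allFin; ∈-length)
open import Data.Nat as ℕ using (ℕ; zero; suc)
open import Data.Nat.Induction using (Acc; acc; <-wellFounded)
import Data.Nat.Properties as ℕ
import Data.Nat.Tactic.RingSolver as ℕ-Ring
open import Data.Product using (Σ; _×_; _,_; proj₁; proj₂)
open import Data.Sum using (_⊎_; inj₁; inj₂)
open import Data.Vec using (Vec; []; _∷_; _++_; head; tail; take; drop; map; zipWith; replicate; lookup; tabulate)
open import Data.Vec.Properties using (take-zipWith; drop-zipWith; take-map; drop-map; take++drop≡id; zipWith-++; map-++; lookup-zipWith; lookup-map; lookup∘tabulate; tabulate-cong; tabulate-∘)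
open import Function using (_∘_; Inverse; Equivalence; Injection; mk⇔; _↔_)
open import Function.Properties.Inverse using (↔⇒↣)
open import Relation.Binary.PropositionalEquality
open import Relation.Nullary using (yes; no; contradiction)
open import Algebra.Properties.Semiring.Sum ℤ.+-*-semiring using (sum; sum-syntax; sum-cong-≗; ∑-distrib-+; ∑-comm; sum-permute; sum-replicate-zero; *-distribˡ-sum; *-distribʳ-sum)

private variable
  m n p : ℕ

-- Rational and integral sums of two squares

IsSumOfTwoSquares : ℤ → Set
IsSumOfTwoSquares n = Σ ℤ λ a → Σ ℤ λ b → n ≡ a * a + b * b

-- When twice the Euclidean remainder exceeds `c`, the quotient is rounded up and the remainder
-- turns negative. Remainders of size at most c/2 are what makes the denominator drop in the descent
-- below.
nearest-multiple : ∀ a c .{{_ : ℕ.NonZero c}} →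
  Σ ℤ λ p → Σ ℤ λ r → a ≡ p * + c + r × 2 ℕ.* ∣ r ∣ ℕ.≤ c
nearest-multiple a c with 2 ℕ.* (a %ℕ c) ℕ.≤? c
... | yes small = a /ℕ c , + (a %ℕ c) ,
  trans (a≡a%ℕn+[a/ℕn]*n a c) (ℤ.+-comm (+ (a %ℕ c)) (a /ℕ c * + c)) , small
... | no large = a /ℕ c + 1ℤ , - (+ (c ℕ.∸ ρ)) , eq , bound
  where
  ρ = a %ℕ c
  ρ≤c : ρ ℕ.≤ c
  ρ≤c = ℕ.<⇒≤ (n%ℕd<d a c)
  split : + c ≡ + (c ℕ.∸ ρ) + + ρ
  split = cong +_ (sym (ℕ.m∸n+n≡m ρ≤c))
  shift : ∀ q d x y → d ≡ y + x → x + q * d ≡ (q + 1ℤ) * d + - y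
  shift q _ x y refl = lemma q x y
    where
    lemma : ∀ q x y → x + q * (y + x) ≡ (q + 1ℤ) * (y + x) + - y
    lemma = solve-∀
  eq : a ≡ (a /ℕ c + 1ℤ) * + c + - (+ (c ℕ.∸ ρ))
  eq = trans (a≡a%ℕn+[a/ℕn]*n a c) (shift (a /ℕ c) (+ c) (+ ρ) (+ (c ℕ.∸ ρ)) split)
  bound : 2 ℕ.* ∣ - (+ (c ℕ.∸ ρ)) ∣ ℕ.≤ c
  bound rewrite ℤ.∣-i∣≡∣i∣ (+ (c ℕ.∸ ρ)) = begin
    2 ℕ.* (c ℕ.∸ ρ)         ≡⟨ ℕ.*-distribˡ-∸ 2 c ρ ⟩
    2 ℕ.* c ℕ.∸ 2 ℕ.* ρ     ≤⟨ ℕ.∸-monoʳ-≤ (2 ℕ.* c) (ℕ.<⇒≤ (ℕ.≰⇒> large)) ⟩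
    2 ℕ.* c ℕ.∸ c           ≡⟨ cong (ℕ._∸ c) (ℕ.+-comm c (c ℕ.+ 0)) ⟩
    c ℕ.+ 0 ℕ.+ c ℕ.∸ c     ≡⟨ ℕ.m+n∸n≡m (c ℕ.+ 0) c ⟩
    c ℕ.+ 0                 ≡⟨ ℕ.+-identityʳ c ⟩
    c                       ∎
    where open ℕ.≤-Reasoning

double≡0 : ∀ x → x + x ≡ 0ℤ → x ≡ 0ℤ
double≡0 (+ zero) _ = refl

x≡-x⇒x≡0 : ∀ x → x ≡ - x → x ≡ 0ℤ
x≡-x⇒x≡0 (+ zero) _ = refl

square-∣∣ : ∀ i → + (∣ i ∣ ℕ.* ∣ i ∣) ≡ i * i
square-∣∣ (+ i) = ℤ.pos-* i i
square-∣∣ -[1+ i ] = refl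

-- If c ≤ d, then 4c² ≤ 4cd = (2x)² + (2y)² ≤ 2c², which is impossible for nonzero `c`.
residues-small : ∀ c d x y .{{_ : ℕ.NonZero c}} → 2 ℕ.* x ℕ.≤ c → 2 ℕ.* y ℕ.≤ c →
  c ℕ.* d ≡ x ℕ.* x ℕ.+ y ℕ.* y → d ℕ.< c
residues-small c d x y 2x≤c 2y≤c eq = ℕ.≰⇒> λ c≤d →
  contradiction (ℕ.*-cancelʳ-≤ 4 2 (c ℕ.* c) {{ℕ.m*n≢0 c c}} (begin
    4 ℕ.* (c ℕ.* c)                                     ≤⟨ ℕ.*-monoʳ-≤ 4 (ℕ.*-monoʳ-≤ c c≤d) ⟩
    4 ℕ.* (c ℕ.* d)                                     ≡⟨ cong (4 ℕ.*_) eq ⟩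
    4 ℕ.* (x ℕ.* x ℕ.+ y ℕ.* y)                         ≡⟨ expand x y ⟩
    2 ℕ.* x ℕ.* (2 ℕ.* x) ℕ.+ 2 ℕ.* y ℕ.* (2 ℕ.* y)     ≤⟨ ℕ.+-mono-≤ (ℕ.*-mono-≤ 2x≤c 2x≤c) (ℕ.*-mono-≤ 2y≤c 2y≤c) ⟩
    c ℕ.* c ℕ.+ c ℕ.* c                                 ≡⟨ cong (c ℕ.* c ℕ.+_) (sym (ℕ.+-identityʳ (c ℕ.* c))) ⟩
    2 ℕ.* (c ℕ.* c)                                     ∎)) λ { (ℕ.s≤s (ℕ.s≤s ())) }
  where
  open ℕ.≤-Reasoning
  expand : ∀ x y → 4 ℕ.* (x ℕ.* x ℕ.+ y ℕ.* y) ≡ 2 ℕ.* x ℕ.* (2 ℕ.* x) ℕ.+ 2 ℕ.* y ℕ.* (2 ℕ.* y)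
  expand = ℕ-Ring.solve-∀

-- Davenport–Cassels: the line through (a/c , b/c) and a nearest lattice point
-- (p , q) meets the circle x² + y² = n again in a point with denominator e < c.
module SecondIntersection (n c p q r s : ℤ)
    (onCircle : n * (c * c) ≡ (p * c + r) * (p * c + r) + (q * c + s) * (q * c + s)) where
  N e : ℤ
  N = p * p + q * q
  e = c * n - c * N - (p * r + q * s) - (p * r + q * s)

  -- So `e` is (r² + s²)/c written without division: in the expanded circle equation every term
  -- other than r² + s² carries a factor `c`.
  c*e : c * e ≡ r * r + s * s
  c*e = begin
    c * e ≡⟨ left n c p q r s ⟩
    n * (c * c) - rest
      ≡⟨ cong (_- rest) onCircle ⟩
    (p * c + r) * (p * c + r) + (q * c + s) * (q * c + s) - rest
      ≡⟨ right c p q r s ⟩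
    r * r + s * s ∎
    where
    open ≡-Reasoning
    rest = c * (c * (p * p + q * q) + (p * r + q * s) + (p * r + q * s))
    left : ∀ n c p q r s →
      c * (c * n - c * (p * p + q * q) - (p * r + q * s) - (p * r + q * s))
      ≡ n * (c * c) - c * (c * (p * p + q * q) + (p * r + q * s) + (p * r + q * s))
    left = solve-∀
    right : ∀ c p q r s →
      (p * c + r) * (p * c + r) + (q * c + s) * (q * c + s)
        - c * (c * (p * p + q * q) + (p * r + q * s) + (p * r + q * s))
      ≡ r * r + s * s
    right = solve-∀

  -- On the line (p + x r , q + x s) the circle equation is a quadratic in x with leading
  -- coefficient r² + s² = c e, constant term N - n and root 1/c. The product of the roots gives the
  -- other one as (N - n)/e.
  second : n * (e * e) ≡ (p * e + (N - n) * r) * (p * e + (N - n) * r)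
                       + (q * e + (N - n) * s) * (q * e + (N - n) * s)
  second = sym (begin
    (p * e + (N - n) * r) * (p * e + (N - n) * r) + (q * e + (N - n) * s) * (q * e + (N - n) * s)
      ≡⟨ expand n e p q r s ⟩
    rest + (N - n) * (N - n) * (r * r + s * s)
      ≡⟨ cong (λ t → rest + (N - n) * (N - n) * t) (sym c*e) ⟩
    rest + (N - n) * (N - n) * (c * e)
      -- By definition c(N - n) + 2(pr + qs) = -e, so the sum collapses to N e² - (N - n) e².
      ≡⟨ collect n c p q r s ⟩
    n * (e * e) ∎)
    where
    open ≡-Reasoning
    rest = N * (e * e) + (N - n) * e * (p * r + q * s + (p * r + q * s))
    expand : ∀ n e p q r s → let N = p * p + q * q in
      (p * e + (N - n) * r) * (p * e + (N - n) * r) + (q * e + (N - n) * s) * (q * e + (N - n) * s)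
      ≡ N * (e * e) + (N - n) * e * (p * r + q * s + (p * r + q * s)) + (N - n) * (N - n) * (r * r + s * s)
    expand = solve-∀
    collect : ∀ n c p q r s → let N = p * p + q * q
                                  e = c * n - c * N - (p * r + q * s) - (p * r + q * s) in
      N * (e * e) + (N - n) * e * (p * r + q * s + (p * r + q * s)) + (N - n) * (N - n) * (c * e)
      ≡ n * (e * e)
    collect = solve-∀

-- Strong induction on the denominator: each second intersection replaces `c` by the smaller |e|,
-- until the nearest lattice point itself lies on the circle.
rational⇒integral : ∀ n c .{{_ : ℕ.NonZero c}} →
  IsSumOfTwoSquares (n * (+ c * + c)) → IsSumOfTwoSquares n
rational⇒integral n c = descend c (<-wellFounded c)
  where
  descend : ∀ c → Acc ℕ._<_ c → .{{_ : ℕ.NonZero c}} →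
    IsSumOfTwoSquares (n * (+ c * + c)) → IsSumOfTwoSquares n
  descend c (acc rec) (a , b , eq) with nearest-multiple a c | nearest-multiple b c
  ... | p , r , refl , r-small | q , s , refl , s-small = go ∣ e ∣ refl
    where
    open SecondIntersection n (+ c) p q r s eq
    c*∣e∣ : c ℕ.* ∣ e ∣ ≡ ∣ r ∣ ℕ.* ∣ r ∣ ℕ.+ ∣ s ∣ ℕ.* ∣ s ∣
    c*∣e∣ = begin
      c ℕ.* ∣ e ∣                                      ≡⟨ sym (ℤ.abs-* (+ c) e) ⟩
      ∣ + c * e ∣                                      ≡⟨ cong ∣_∣ c*e ⟩
      ∣ r * r + s * s ∣                                ≡⟨ cong₂ (λ x y → ∣ x + y ∣) (sym (square-∣∣ r)) (sym (square-∣∣ s)) ⟩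
      ∣ r ∣ ℕ.* ∣ r ∣ ℕ.+ ∣ s ∣ ℕ.* ∣ s ∣              ∎
      where open ≡-Reasoning
    go : ∀ d → ∣ e ∣ ≡ d → IsSumOfTwoSquares n
    -- Here r² + s² = c|e| vanishes, so (a/c , b/c) is already the lattice point (p , q).
    go zero ∣e∣≡0 = p , q , ℤ.*-cancelʳ-≡ n (p * p + q * q) (+ c * + c) {{ℤ.i*j≢0 (+ c) (+ c)}} (begin
      n * (+ c * + c)                                   ≡⟨ eq ⟩
      (p * + c + r) * (p * + c + r) + (q * + c + s) * (q * + c + s)
        ≡⟨ cong₂ (λ x y → (p * + c + x) * (p * + c + x) + (q * + c + y) * (q * + c + y)) r≡0 s≡0 ⟩
      (p * + c + 0ℤ) * (p * + c + 0ℤ) + (q * + c + 0ℤ) * (q * + c + 0ℤ)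
        ≡⟨ factor p q (+ c) ⟩
      (p * p + q * q) * (+ c * + c)                     ∎)
      where
      open ≡-Reasoning
      squares≡0 : ∣ r ∣ ℕ.* ∣ r ∣ ℕ.+ ∣ s ∣ ℕ.* ∣ s ∣ ≡ 0
      squares≡0 = trans (sym c*∣e∣) (trans (cong (c ℕ.*_) ∣e∣≡0) (ℕ.*-zeroʳ c))
      square≡0 : ∀ i → ∣ i ∣ ℕ.* ∣ i ∣ ≡ 0 → i ≡ 0ℤ
      square≡0 (+ zero) _ = refl
      r≡0 = square≡0 r (ℕ.m+n≡0⇒m≡0 _ squares≡0)
      s≡0 = square≡0 s (ℕ.m+n≡0⇒n≡0 (∣ r ∣ ℕ.* ∣ r ∣) squares≡0)
      factor : ∀ p q c → (p * c + 0ℤ) * (p * c + 0ℤ) + (q * c + 0ℤ) * (q * c + 0ℤ)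
             ≡ (p * p + q * q) * (c * c)
      factor = solve-∀
    go (suc d) ∣e∣≡d = descend (suc d)
      (rec (subst (ℕ._< c) ∣e∣≡d (residues-small c (∣ e ∣) (∣ r ∣) (∣ s ∣) r-small s-small c*∣e∣)))
      (p * e + (N - n) * r , q * e + (N - n) * s ,
       trans (cong (n *_) (trans (cong (λ x → + x * + x) (sym ∣e∣≡d))
                            (trans (sym (ℤ.pos-* ∣ e ∣ ∣ e ∣)) (square-∣∣ e)))) second)

-- Similitudes of integer lattices

infixl 6 _⊕_
infixr 7 _·_

_⊕_ : Vec ℤ n → Vec ℤ n → Vec ℤ n
_⊕_ = zipWith _+_

_·_ : ℤ → Vec ℤ n → Vec ℤ n
c · x = map (c *_) x

dot : Vec ℤ n → Vec ℤ n → ℤ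
dot [] [] = 0ℤ
dot (a ∷ x) (b ∷ y) = a * b + dot x y

norm : Vec ℤ n → ℤ
norm x = dot x x

dot-comm : (x y : Vec ℤ n) → dot x y ≡ dot y x
dot-comm [] [] = refl
dot-comm (a ∷ x) (b ∷ y) = cong₂ _+_ (ℤ.*-comm a b) (dot-comm x y)

dot-⊕ˡ : (x y z : Vec ℤ n) → dot (x ⊕ y) z ≡ dot x z + dot y z
dot-⊕ˡ [] [] [] = refl
dot-⊕ˡ (a ∷ x) (b ∷ y) (c ∷ z) =
  trans (cong (_+_ ((a + b) * c)) (dot-⊕ˡ x y z)) (lemma a b c (dot x z) (dot y z))
  where
  lemma : ∀ a b c s t → (a + b) * c + (s + t) ≡ a * c + s + (b * c + t)
  lemma = solve-∀

dot-⊕ʳ : (x y z : Vec ℤ n) → dot x (y ⊕ z) ≡ dot x y + dot x z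
dot-⊕ʳ x y z = trans (dot-comm x (y ⊕ z))
  (trans (dot-⊕ˡ y z x) (cong₂ _+_ (dot-comm y x) (dot-comm z x)))

dot-·ˡ : ∀ c (x y : Vec ℤ n) → dot (c · x) y ≡ c * dot x y
dot-·ˡ c [] [] = sym (ℤ.*-zeroʳ c)
dot-·ˡ c (a ∷ x) (b ∷ y) = trans (cong (_+_ (c * a * b)) (dot-·ˡ c x y)) (lemma c a b (dot x y))
  where
  lemma : ∀ c a b s → c * a * b + c * s ≡ c * (a * b + s)
  lemma = solve-∀

dot-·ʳ : ∀ c (x y : Vec ℤ n) → dot x (c · y) ≡ c * dot x y
dot-·ʳ c x y = trans (dot-comm x (c · y)) (trans (dot-·ˡ c y x) (cong (c *_) (dot-comm y x)))

dot-++ : (x x′ : Vec ℤ m) (y y′ : Vec ℤ n) → dot (x ++ y) (x′ ++ y′) ≡ dot x x′ + dot y y′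
dot-++ [] [] y y′ = sym (ℤ.+-identityˡ _)
dot-++ (a ∷ x) (b ∷ x′) y y′ =
  trans (cong (_+_ (a * b)) (dot-++ x x′ y y′)) (sym (ℤ.+-assoc (a * b) _ _))

dot-splitʳ : (x : Vec ℤ m) (y : Vec ℤ n) (z : Vec ℤ (m ℕ.+ n)) →
  dot (x ++ y) z ≡ dot x (take m z) + dot y (drop m z)
dot-splitʳ {m} x y z = trans (cong (dot (x ++ y)) (sym (take++drop≡id m z))) (dot-++ x _ y _)

dot-splitˡ : (z : Vec ℤ (m ℕ.+ n)) (x : Vec ℤ m) (y : Vec ℤ n) →
  dot z (x ++ y) ≡ dot (take m z) x + dot (drop m z) y
dot-splitˡ {m} z x y = trans (dot-comm z (x ++ y))
  (trans (dot-splitʳ x y z) (cong₂ _+_ (dot-comm x _) (dot-comm y _)))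

norm-split : ∀ m (z : Vec ℤ (m ℕ.+ n)) → norm z ≡ norm (take m z) + norm (drop m z)
norm-split m z = trans (cong norm (sym (take++drop≡id m z))) (dot-++ (take m z) (take m z) (drop m z) (drop m z))

norm-⊕ : (x y : Vec ℤ n) → norm (x ⊕ y) ≡ norm x + (dot x y + dot x y) + norm y
norm-⊕ x y = begin
  norm (x ⊕ y)                            ≡⟨ dot-⊕ˡ x y (x ⊕ y) ⟩
  dot x (x ⊕ y) + dot y (x ⊕ y)           ≡⟨ cong₂ _+_ (dot-⊕ʳ x x y) (dot-⊕ʳ y x y) ⟩
  norm x + dot x y + (dot y x + norm y)   ≡⟨ cong (λ t → norm x + dot x y + (t + norm y)) (dot-comm y x) ⟩
  norm x + dot x y + (dot x y + norm y)   ≡⟨ lemma (norm x) (dot x y) (norm y) ⟩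
  norm x + (dot x y + dot x y) + norm y   ∎
  where
  open ≡-Reasoning
  lemma : ∀ a b c → a + b + (b + c) ≡ a + (b + b) + c
  lemma = solve-∀

norm-· : ∀ c (x : Vec ℤ n) → norm (c · x) ≡ c * c * norm x
norm-· c x = trans (dot-·ˡ c x (c · x))
  (trans (cong (c *_) (dot-·ʳ c x x)) (sym (ℤ.*-assoc c c (norm x))))

record Linear (f : Vec ℤ m → Vec ℤ n) : Set where
  field
    additive    : ∀ x y → f (x ⊕ y) ≡ f x ⊕ f y
    homogeneous : ∀ c x → f (c · x) ≡ c · f x
open Linear

id-linear : Linear {m} (λ x → x)
id-linear .additive x y = refl
id-linear .homogeneous c x = refl

∘-linear : {f : Vec ℤ n → Vec ℤ p} {g : Vec ℤ m → Vec ℤ n} → Linear f → Linear g → Linear (f ∘ g)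
∘-linear {f = f} F G .additive x y = trans (cong f (additive G x y)) (additive F _ _)
∘-linear {f = f} F G .homogeneous c x = trans (cong f (homogeneous G c x)) (homogeneous F c _)

take-linear : ∀ m → Linear (take m {n})
take-linear m .additive x y = take-zipWith _+_ x y
take-linear m .homogeneous c x = take-map (c *_) m x

drop-linear : ∀ m → Linear (drop m {n})
drop-linear m .additive x y = drop-zipWith {m = m} _+_ x y
drop-linear m .homogeneous c x = drop-map (c *_) m x

++-linear : {f : Vec ℤ m → Vec ℤ n} {g : Vec ℤ m → Vec ℤ p} →
  Linear f → Linear g → Linear (λ x → f x ++ g x)
++-linear {f = f} {g} F G .additive x y = trans (cong₂ _++_ (additive F x y) (additive G x y))
  (sym (zipWith-++ _+_ (f x) (g x) (f y) (g y)))
++-linear {f = f} {g} F G .homogeneous c x =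
  trans (cong₂ _++_ (homogeneous F c x) (homogeneous G c x)) (sym (map-++ (c *_) (f x) (g x)))

⊕-interchange : (a b c d : Vec ℤ n) → (a ⊕ b) ⊕ (c ⊕ d) ≡ (a ⊕ c) ⊕ (b ⊕ d)
⊕-interchange [] [] [] [] = refl
⊕-interchange (a ∷ as) (b ∷ bs) (c ∷ cs) (d ∷ ds) = cong₂ _∷_ (lemma a b c d) (⊕-interchange as bs cs ds)
  where
  lemma : ∀ a b c d → a + b + (c + d) ≡ a + c + (b + d)
  lemma = solve-∀

·-distrib-⊕ : ∀ c (x y : Vec ℤ n) → c · (x ⊕ y) ≡ c · x ⊕ c · y
·-distrib-⊕ c [] [] = refl
·-distrib-⊕ c (a ∷ x) (b ∷ y) = cong₂ _∷_ (ℤ.*-distribˡ-+ c a b) (·-distrib-⊕ c x y)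

·-swap : ∀ c d (x : Vec ℤ n) → c · d · x ≡ d · c · x
·-swap c d [] = refl
·-swap c d (a ∷ x) = cong₂ _∷_ (lemma c d a) (·-swap c d x)
  where
  lemma : ∀ c d a → c * (d * a) ≡ d * (c * a)
  lemma = solve-∀

⊕-linear : {f g : Vec ℤ m → Vec ℤ n} → Linear f → Linear g → Linear (λ x → f x ⊕ g x)
⊕-linear {f = f} {g} F G .additive x y =
  trans (cong₂ _⊕_ (additive F x y) (additive G x y)) (⊕-interchange (f x) (f y) (g x) (g y))
⊕-linear {f = f} {g} F G .homogeneous c x =
  trans (cong₂ _⊕_ (homogeneous F c x) (homogeneous G c x)) (sym (·-distrib-⊕ c (f x) (g x)))

·-linear : ∀ d {f : Vec ℤ m → Vec ℤ n} → Linear f → Linear (λ x → d · f x)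
·-linear d {f} F .additive x y = trans (cong (d ·_) (additive F x y)) (·-distrib-⊕ d (f x) (f y))
·-linear d {f} F .homogeneous c x = trans (cong (d ·_) (homogeneous F c x)) (·-swap d c (f x))

-- The coordinate-free form of an integral matrix M with Mᵀ M = vI.
record Similitude (v : ℤ) (n : ℕ) : Set where
  field
    apply    : Vec ℤ n → Vec ℤ n
    linear   : Linear apply
    norm-apply : ∀ x → norm (apply x) ≡ v * norm x
open Similitude

directSum : ∀ {v} → Similitude v m → Similitude v n → Similitude v (m ℕ.+ n)
directSum {m} S T .apply z = apply S (take m z) ++ apply T (drop m z)
directSum {m} S T .linear = ++-linear (∘-linear (linear S) (take-linear m)) (∘-linear (linear T) (drop-linear m))
directSum {m} {v = v} S T .norm-apply z = begin
  norm (apply S x ++ apply T y)         ≡⟨ dot-++ (apply S x) _ (apply T y) _ ⟩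
  norm (apply S x) + norm (apply T y)   ≡⟨ cong₂ _+_ (norm-apply S x) (norm-apply T y) ⟩
  v * norm x + v * norm y               ≡⟨ sym (ℤ.*-distribˡ-+ v (norm x) (norm y)) ⟩
  v * (norm x + norm y)                 ≡⟨ cong (v *_) (sym (norm-split m z)) ⟩
  v * norm z                            ∎
  where
  open ≡-Reasoning
  x = take m z
  y = drop m z

copies : ∀ {v} r → Similitude v n → Similitude v (r ℕ.* n)
copies zero S .apply x = x
copies zero S .linear = id-linear
copies {v = v} zero S .norm-apply [] = sym (ℤ.*-zeroʳ v)
copies (suc r) S = directSum S (copies r S)

-- A matrix together with its transpose, both of ratio v. Doubling needs Hᵀ H = vI as well as H Hᵀ =
-- vI, and adjointness to cancel the cross terms.
record AdjointPair (v : ℤ) (n : ℕ) : Set where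
  field
    S T     : Similitude v n
    adjoint : ∀ x y → dot (apply S x) y ≡ dot x (apply T y)

-- The blocks [ H , I ; −I , Hᵀ ] form a similitude of ratio v + 1 when H has ratio v.
double : ∀ {v} → AdjointPair v n → AdjointPair (v + 1ℤ) (n ℕ.+ n)
double {n} {v} P = record { S = S′ ; T = T′ ; adjoint = adjoint′ }
  where
  open AdjointPair P
  open ≡-Reasoning
  L = take-linear {n} n
  R = drop-linear {n} n
  S′ T′ : Similitude (v + 1ℤ) (n ℕ.+ n)
  S′ .apply z = (apply S (take n z) ⊕ drop n z) ++ (-1ℤ · take n z ⊕ apply T (drop n z))
  S′ .linear = ++-linear (⊕-linear (∘-linear (linear S) L) R)
                         (⊕-linear (·-linear -1ℤ L) (∘-linear (linear T) R))
  S′ .norm-apply z = begin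
    norm ((apply S x ⊕ y) ++ (-1ℤ · x ⊕ apply T y))
      ≡⟨ dot-++ (apply S x ⊕ y) _ (-1ℤ · x ⊕ apply T y) _ ⟩
    norm (apply S x ⊕ y) + norm (-1ℤ · x ⊕ apply T y)
      ≡⟨ cong₂ _+_ (norm-⊕ (apply S x) y) (norm-⊕ (-1ℤ · x) (apply T y)) ⟩
    norm (apply S x) + (dot (apply S x) y + dot (apply S x) y) + norm y
      + (norm (-1ℤ · x) + (dot (-1ℤ · x) (apply T y) + dot (-1ℤ · x) (apply T y)) + norm (apply T y))
      ≡⟨ cong₂ _+_
           (cong₂ (λ a b → a + (b + b) + norm y) (norm-apply S x) (adjoint x y))
           (cong₂ _+_ (cong₂ (λ a b → a + (b + b)) (norm-· -1ℤ x) (dot-·ˡ -1ℤ x (apply T y))) (norm-apply T y)) ⟩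
    v * norm x + (b + b) + norm y + (-1ℤ * -1ℤ * norm x + (-1ℤ * b + -1ℤ * b) + v * norm y)
      -- The upper block contributes the cross term 2b and the lower block -2b; each of the two
      -- norms is counted v times by `S` or `T` and once by ±I.
      ≡⟨ lemma v (norm x) b (norm y) ⟩
    (v + 1ℤ) * (norm x + norm y)
      ≡⟨ cong ((v + 1ℤ) *_) (sym (norm-split n z)) ⟩
    (v + 1ℤ) * norm z ∎
    where
    x = take n z
    y = drop n z
    b = dot x (apply T y)
    lemma : ∀ v a b c → v * a + (b + b) + c + (-1ℤ * -1ℤ * a + (-1ℤ * b + -1ℤ * b) + v * c)
          ≡ (v + 1ℤ) * (a + c)
    lemma = solve-∀
  -- The transposed blocks [ Hᵀ , -I ; I , H ].
  T′ .apply z = (apply T (take n z) ⊕ -1ℤ · drop n z) ++ (take n z ⊕ apply S (drop n z))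
  T′ .linear = ++-linear (⊕-linear (∘-linear (linear T) L) (·-linear -1ℤ R))
                         (⊕-linear L (∘-linear (linear S) R))
  T′ .norm-apply z = begin
    norm ((apply T x ⊕ -1ℤ · y) ++ (x ⊕ apply S y))
      ≡⟨ dot-++ (apply T x ⊕ -1ℤ · y) _ (x ⊕ apply S y) _ ⟩
    norm (apply T x ⊕ -1ℤ · y) + norm (x ⊕ apply S y)
      ≡⟨ cong₂ _+_ (norm-⊕ (apply T x) (-1ℤ · y)) (norm-⊕ x (apply S y)) ⟩
    norm (apply T x) + (dot (apply T x) (-1ℤ · y) + dot (apply T x) (-1ℤ · y)) + norm (-1ℤ · y)
      + (norm x + (dot x (apply S y) + dot x (apply S y)) + norm (apply S y))
      ≡⟨ cong₂ _+_
           (cong₂ _+_ (cong₂ (λ a b → a + (b + b)) (norm-apply T x)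
             (trans (dot-·ʳ -1ℤ (apply T x) y) (cong (-1ℤ *_) swap))) (norm-· -1ℤ y))
           (cong (_+_ (norm x + (b + b))) (norm-apply S y)) ⟩
    v * norm x + (-1ℤ * b + -1ℤ * b) + -1ℤ * -1ℤ * norm y + (norm x + (b + b) + v * norm y)
      ≡⟨ lemma v (norm x) b (norm y) ⟩
    (v + 1ℤ) * (norm x + norm y)
      ≡⟨ cong ((v + 1ℤ) *_) (sym (norm-split n z)) ⟩
    (v + 1ℤ) * norm z ∎
    where
    x = take n z
    y = drop n z
    b = dot x (apply S y)
    swap : dot (apply T x) y ≡ b
    swap = trans (dot-comm (apply T x) y) (trans (sym (adjoint y x)) (dot-comm (apply S y) x))
    lemma : ∀ v a b c → v * a + (-1ℤ * b + -1ℤ * b) + -1ℤ * -1ℤ * c + (a + (b + b) + v * c)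
          ≡ (v + 1ℤ) * (a + c)
    lemma = solve-∀
  adjoint′ : ∀ z w → dot (apply S′ z) w ≡ dot z (apply T′ w)
  adjoint′ z w = begin
    dot (apply S′ z) w
      ≡⟨ dot-splitʳ (apply S x ⊕ y) (-1ℤ · x ⊕ apply T y) w ⟩
    dot (apply S x ⊕ y) x′ + dot (-1ℤ · x ⊕ apply T y) y′
      ≡⟨ cong₂ _+_ (dot-⊕ˡ (apply S x) y x′) (dot-⊕ˡ (-1ℤ · x) (apply T y) y′) ⟩
    dot (apply S x) x′ + dot y x′ + (dot (-1ℤ · x) y′ + dot (apply T y) y′)
      ≡⟨ cong₂ (λ a b → a + dot y x′ + b) (adjoint x x′)
           (cong₂ _+_ (trans (dot-·ˡ -1ℤ x y′) (sym (dot-·ʳ -1ℤ x y′)))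
             (trans (dot-comm (apply T y) y′) (trans (sym (adjoint y′ y)) (dot-comm (apply S y′) y)))) ⟩
    dot x (apply T x′) + dot y x′ + (dot x (-1ℤ · y′) + dot y (apply S y′))
      ≡⟨ lemma (dot x (apply T x′)) (dot y x′) (dot x (-1ℤ · y′)) (dot y (apply S y′)) ⟩
    dot x (apply T x′) + dot x (-1ℤ · y′) + (dot y x′ + dot y (apply S y′))
      ≡⟨ sym (cong₂ _+_ (dot-⊕ʳ x (apply T x′) (-1ℤ · y′)) (dot-⊕ʳ y x′ (apply S y′))) ⟩
    dot x (apply T x′ ⊕ -1ℤ · y′) + dot y (x′ ⊕ apply S y′)
      ≡⟨ sym (dot-splitˡ z (apply T x′ ⊕ -1ℤ · y′) (x′ ⊕ apply S y′)) ⟩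
    dot z (apply T′ w) ∎
    where
    x = take n z
    y = drop n z
    x′ = take n w
    y′ = drop n w
    lemma : ∀ a b c d → a + b + (c + d) ≡ a + c + (b + d)
    lemma = solve-∀

-- The 1 × 1 zero matrix has ratio 0, and each doubling raises the ratio by one. Every ratio is thus
-- reached in an order that is a power of two, modulo which odd numbers are invertible;
-- `odd-inverse` relies on this to match orders.
doubled : ∀ v → AdjointPair (+ v) (2 ℕ.^ v)
doubled zero = record { S = O ; T = O ; adjoint = λ { (a ∷ []) (b ∷ []) → lemma a b } }
  where
  O : Similitude 0ℤ 1
  O .apply x = 0ℤ · x
  O .linear = ·-linear 0ℤ id-linear
  O .norm-apply x = norm-· 0ℤ x
  lemma : ∀ a b → 0ℤ * a * b + 0ℤ ≡ a * (0ℤ * b) + 0ℤ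
  lemma = solve-∀
doubled (suc v) = subst₂ AdjointPair (cong +_ (ℕ.+-comm v 1))
  (cong (2 ℕ.^ v ℕ.+_) (sym (ℕ.+-identityʳ (2 ℕ.^ v)))) (double (doubled v))

-- Witt cancellation and similitudes of order twice an odd number

extend : ∀ p → (Vec ℤ m → ℤ) → Vec ℤ (p ℕ.+ m) → ℤ
extend p Q z = norm (take p z) + Q (drop p z)

-- Witt cancellation: on the hyperplane where the first output coordinate is ±c
-- times the first input coordinate (the sign chosen so that the equation can be
-- solved for that input), the two squares cancel.
cancel-norm : ∀ p {Q : Vec ℤ m → ℤ} → (∀ d z → Q (d · z) ≡ d * d * Q z) →
  ∀ c → c ≢ 0ℤ → (f : Vec ℤ (p ℕ.+ m) → Vec ℤ (p ℕ.+ m)) → Linear f →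
  (∀ z → norm (f z) ≡ c * c * extend p Q z) →
  Σ ℤ λ d → d ≢ 0ℤ × Σ (Vec ℤ m → Vec ℤ m) λ g → Linear g × (∀ z → norm (g z) ≡ d * d * Q z)
cancel-norm zero {Q} Q-hom c c≢0 f F f-norm =
  c , c≢0 , f , F , λ z → trans (f-norm z) (cong (c * c *_) (ℤ.+-identityˡ (Q z)))
cancel-norm {m} (suc p) {Q} Q-hom c c≢0 f F f-norm =
  cancel-norm p Q-hom (c * D) cD≢0 g G g-norm
  where
  open ≡-Reasoning
  e₁ : Vec ℤ (suc p ℕ.+ m)
  e₁ = 1ℤ ∷ replicate (p ℕ.+ m) 0ℤ
  -- By linearity the first coordinate of f (a ∷ z) is α a + ρ z.
  α = head (f e₁)
  ρ : Vec ℤ (p ℕ.+ m) → ℤ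
  ρ z = head (f (0ℤ ∷ z))
  -- Take e = c unless α = c; in that case e = -c works, because α + c = 2c is nonzero.
  sign : Σ ℤ λ e → e * e ≡ c * c × α - e ≢ 0ℤ
  sign with α ℤ.≟ c
  ... | no α≢c = c , refl , λ eq → α≢c (ℤ.i-j≡0⇒i≡j α c eq)
  ... | yes α≡c = - c , neg-square c , λ eq →
        c≢0 (double≡0 c (trans (sym (minus-neg c)) (trans (cong (_- - c) (sym α≡c)) eq)))
    where
    neg-square : ∀ c → - c * - c ≡ c * c
    neg-square = solve-∀
    minus-neg : ∀ c → c - - c ≡ c + c
    minus-neg = solve-∀
  e = proj₁ sign
  e² = proj₁ (proj₂ sign)
  D = α - e
  D≢0 : D ≢ 0ℤ
  D≢0 = proj₂ (proj₂ sign)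
  cD≢0 : c * D ≢ 0ℤ
  cD≢0 eq with ℤ.i*j≡0⇒i≡0∨j≡0 c eq
  ... | inj₁ c≡0 = c≢0 c≡0
  ... | inj₂ D≡0 = D≢0 D≡0
  -- The hyperplane α a + ρ z = e a has the solution a = -ρ z / (α - e). Scaling the whole vector by
  -- D = α - e keeps it integral, at the price of a factor D in the new ratio root.
  h : Vec ℤ (p ℕ.+ m) → Vec ℤ (suc p ℕ.+ m)
  h z = - ρ z ∷ D · z
  padded : Linear (λ (z : Vec ℤ (p ℕ.+ m)) → 0ℤ ∷ z)
  padded .additive x y = refl
  padded .homogeneous c x = cong (_∷ c · x) (sym (ℤ.*-zeroʳ c))
  head-⊕ : (x y : Vec ℤ (suc n)) → head (x ⊕ y) ≡ head x + head y
  head-⊕ (_ ∷ _) (_ ∷ _) = refl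
  head-· : ∀ c (x : Vec ℤ (suc n)) → head (c · x) ≡ c * head x
  head-· c (_ ∷ _) = refl
  ρ-⊕ : ∀ x y → ρ (x ⊕ y) ≡ ρ x + ρ y
  ρ-⊕ x y = trans (cong head (additive (∘-linear F padded) x y)) (head-⊕ (f (0ℤ ∷ x)) (f (0ℤ ∷ y)))
  ρ-· : ∀ c x → ρ (c · x) ≡ c * ρ x
  ρ-· c x = trans (cong head (homogeneous (∘-linear F padded) c x)) (head-· c (f (0ℤ ∷ x)))
  h-linear : Linear h
  h-linear .additive x y = cong₂ _∷_
    (trans (cong -_ (ρ-⊕ x y)) (ℤ.neg-distrib-+ (ρ x) (ρ y))) (·-distrib-⊕ D x y)
  h-linear .homogeneous c x = cong₂ _∷_
    (trans (cong -_ (ρ-· c x)) (ℤ.neg-distribʳ-* c (ρ x))) (·-swap D c x)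
  tail-linear : Linear (tail {A = ℤ} {n = n})
  tail-linear .additive (_ ∷ _) (_ ∷ _) = refl
  tail-linear .homogeneous c (_ ∷ _) = refl
  g : Vec ℤ (p ℕ.+ m) → Vec ℤ (p ℕ.+ m)
  g z = tail (f (h z))
  G : Linear g
  G = ∘-linear tail-linear (∘-linear F h-linear)
  absorb : ∀ a b (z : Vec ℤ n) → b · z ≡ a · replicate n 0ℤ ⊕ b · z
  absorb a b [] = refl
  absorb a b (x ∷ z) = cong₂ _∷_ (lemma a b x) (absorb a b z)
    where
    lemma : ∀ a b x → b * x ≡ a * 0ℤ + b * x
    lemma = solve-∀
  h-decompose : ∀ z → h z ≡ (- ρ z) · e₁ ⊕ D · (0ℤ ∷ z)
  h-decompose z = cong₂ _∷_ (lemma (- ρ z) D) (absorb (- ρ z) D z)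
    where
    lemma : ∀ a b → a ≡ a * 1ℤ + b * 0ℤ
    lemma = solve-∀
  head-fh : ∀ z → head (f (h z)) ≡ - (e * ρ z)
  head-fh z = begin
    head (f (h z))
      ≡⟨ cong (head ∘ f) (h-decompose z) ⟩
    head (f ((- ρ z) · e₁ ⊕ D · (0ℤ ∷ z)))
      ≡⟨ cong head (additive F ((- ρ z) · e₁) (D · (0ℤ ∷ z))) ⟩
    head (f ((- ρ z) · e₁) ⊕ f (D · (0ℤ ∷ z)))
      ≡⟨ head-⊕ (f ((- ρ z) · e₁)) (f (D · (0ℤ ∷ z))) ⟩
    head (f ((- ρ z) · e₁)) + head (f (D · (0ℤ ∷ z)))
      ≡⟨ cong₂ _+_ (trans (cong head (homogeneous F (- ρ z) e₁)) (head-· (- ρ z) (f e₁)))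
                   (trans (cong head (homogeneous F D (0ℤ ∷ z))) (head-· D (f (0ℤ ∷ z)))) ⟩
    - ρ z * α + (α - e) * ρ z
      ≡⟨ lemma (ρ z) α e ⟩
    - (e * ρ z) ∎
    where
    lemma : ∀ r a e → - r * a + (a - e) * r ≡ - (e * r)
    lemma = solve-∀
  norm-tail : (x : Vec ℤ (suc n)) → norm (tail x) ≡ norm x - head x * head x
  norm-tail (a ∷ x) = lemma (a * a) (norm x)
    where
    lemma : ∀ a b → b ≡ a + b - a
    lemma = solve-∀
  extend-· : ∀ d z → extend p Q (d · z) ≡ d * d * extend p Q z
  extend-· d z = begin
    norm (take p (d · z)) + Q (drop p (d · z))
      ≡⟨ cong₂ (λ x y → norm x + Q y) (take-map (d *_) p z) (drop-map (d *_) p z) ⟩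
    norm (d · take p z) + Q (d · drop p z)
      ≡⟨ cong₂ _+_ (norm-· d (take p z)) (Q-hom d (drop p z)) ⟩
    d * d * norm (take p z) + d * d * Q (drop p z)
      ≡⟨ sym (ℤ.*-distribˡ-+ (d * d) (norm (take p z)) (Q (drop p z))) ⟩
    d * d * extend p Q z ∎
  extend-∷ : ∀ a z → extend (suc p) Q (a ∷ z) ≡ a * a + extend p Q z
  extend-∷ a z = ℤ.+-assoc (a * a) _ _
  -- The first input coordinate contributes c² (ρ z)² to the norm of the image and the dropped first
  -- output coordinate removes e² (ρ z)². These agree because e² = c².
  g-norm : ∀ z → norm (g z) ≡ c * D * (c * D) * extend p Q z
  g-norm z = begin
    norm (g z)
      ≡⟨ norm-tail (f (h z)) ⟩
    norm (f (h z)) - head (f (h z)) * head (f (h z))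
      ≡⟨ cong₂ _-_ (trans (f-norm (h z)) (cong (c * c *_)
           (trans (extend-∷ (- ρ z) (D · z)) (cong (_+_ (- ρ z * - ρ z)) (extend-· D z)))))
           (trans (cong (λ t → t * t) (head-fh z)) (square e (ρ z))) ⟩
    c * c * (- ρ z * - ρ z + D * D * extend p Q z) - e * e * (ρ z * ρ z)
      ≡⟨ cong (λ t → c * c * (- ρ z * - ρ z + D * D * extend p Q z) - t * (ρ z * ρ z)) e² ⟩
    c * c * (- ρ z * - ρ z + D * D * extend p Q z) - c * c * (ρ z * ρ z)
      ≡⟨ lemma c (ρ z) D (extend p Q z) ⟩
    c * D * (c * D) * extend p Q z ∎
    where
    square : ∀ e r → - (e * r) * - (e * r) ≡ e * e * (r * r)
    square = solve-∀
    lemma : ∀ c r d q → c * c * (- r * - r + d * d * q) - c * c * (r * r) ≡ c * d * (c * d) * q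
    lemma = solve-∀

-- An inverse of an odd number modulo 2ᵐ, lifted one power of two at a time.
odd-inverse : ∀ s m → Σ ℕ λ r → Σ ℕ λ q → (1 ℕ.+ 2 ℕ.* s) ℕ.* r ≡ 1 ℕ.+ 2 ℕ.^ m ℕ.* q
odd-inverse s zero = 1 , 2 ℕ.* s , lemma s
  where
  lemma : ∀ s → (1 ℕ.+ 2 ℕ.* s) ℕ.* 1 ≡ 1 ℕ.+ 1 ℕ.* (2 ℕ.* s)
  lemma = ℕ-Ring.solve-∀
odd-inverse s (suc m) with odd-inverse s m
... | r , q , eq with parity q
  where
  parity : ∀ q → Σ ℕ λ k → q ≡ 2 ℕ.* k ⊎ q ≡ 1 ℕ.+ 2 ℕ.* k
  parity zero = 0 , inj₁ refl
  parity (suc q) with parity q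
  ... | k , inj₁ refl = k , inj₂ refl
  ... | k , inj₂ refl = suc k , inj₁ (lemma k)
    where
    lemma : ∀ k → 2 ℕ.+ 2 ℕ.* k ≡ 2 ℕ.* (1 ℕ.+ k)
    lemma = ℕ-Ring.solve-∀
... | k , inj₁ refl = r , k , trans eq (lemma (2 ℕ.^ m) k)
  where
  lemma : ∀ x k → 1 ℕ.+ x ℕ.* (2 ℕ.* k) ≡ 1 ℕ.+ 2 ℕ.* x ℕ.* k
  lemma = ℕ-Ring.solve-∀
-- If `q` is odd, adding 2ᵐ to `r` adds the odd number 1 + 2s to `q`, and the new quotient is even.
... | k , inj₂ refl = r ℕ.+ 2 ℕ.^ m , 1 ℕ.+ k ℕ.+ s ,
  trans (ℕ.*-distribˡ-+ (1 ℕ.+ 2 ℕ.* s) r (2 ℕ.^ m))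
    (trans (cong (ℕ._+ (1 ℕ.+ 2 ℕ.* s) ℕ.* 2 ℕ.^ m) eq) (lemma (2 ℕ.^ m) k s))
  where
  lemma : ∀ x k s → 1 ℕ.+ x ℕ.* (1 ℕ.+ 2 ℕ.* k) ℕ.+ (1 ℕ.+ 2 ℕ.* s) ℕ.* x
        ≡ 1 ℕ.+ 2 ℕ.* x ℕ.* (1 ℕ.+ k ℕ.+ s)
  lemma = ℕ-Ring.solve-∀

-- Take r copies of C, where r inverts 1 + 2s modulo 2ⁿ; their order is o + 2 with 2ⁿ dividing o.
-- Comparing them with copies of H on the first o coordinates and cancelling o squares leaves a
-- linear map g of ℤ² with norm (g u) = c² n · norm u. Its value at (1 , 0) writes n c² as a sum of
-- two squares.
similitude⇒sumOfTwoSquares : ∀ n s .{{_ : ℕ.NonZero n}} →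
  Similitude (+ n) (2 ℕ.* (1 ℕ.+ 2 ℕ.* s)) → IsSumOfTwoSquares (+ n)
similitude⇒sumOfTwoSquares n@(suc _) s C with odd-inverse s n
... | r , q , eq = rational⇒integral (+ n) (∣ c ∣) {{ℕ.≢-nonZero (λ ∣c∣≡0 → c≢0 (ℤ.∣i∣≡0⇒i≡0 ∣c∣≡0))}}
                     (split (g (1ℤ ∷ 0ℤ ∷ [])) (g-norm (1ℤ ∷ 0ℤ ∷ [])))
  where
  open ≡-Reasoning
  v = + n
  o = q ℕ.* 2 ℕ.* 2 ℕ.^ n
  order : r ℕ.* (2 ℕ.* (1 ℕ.+ 2 ℕ.* s)) ≡ o ℕ.+ 2
  order = trans (left r s) (trans (cong (2 ℕ.*_) eq) (right (2 ℕ.^ n) q))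
    where
    left : ∀ r s → r ℕ.* (2 ℕ.* (1 ℕ.+ 2 ℕ.* s)) ≡ 2 ℕ.* ((1 ℕ.+ 2 ℕ.* s) ℕ.* r)
    left = ℕ-Ring.solve-∀
    right : ∀ x q → 2 ℕ.* (1 ℕ.+ x ℕ.* q) ≡ q ℕ.* 2 ℕ.* x ℕ.+ 2
    right = ℕ-Ring.solve-∀
  M : Similitude v (o ℕ.+ 2)
  M = subst (Similitude v) order (copies r C)
  H : Similitude v o
  H = copies (q ℕ.* 2) (AdjointPair.S (doubled n))
  -- `H` scales the norm of the first block by v and multiplication by v scales that of the last two
  -- coordinates by v². After `M` the total is v² (norm x + v · norm u): a square ratio, as
  -- cancellation requires, with one factor v left on the last two coordinates.
  f : Vec ℤ (o ℕ.+ 2) → Vec ℤ (o ℕ.+ 2)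
  f z = apply M (apply H (take o z) ++ v · drop o z)
  F : Linear f
  F = ∘-linear (linear M) (++-linear (∘-linear (linear H) (take-linear o)) (·-linear v (drop-linear o)))
  Q : Vec ℤ 2 → ℤ
  Q u = v * norm u
  Q-hom : ∀ d u → Q (d · u) ≡ d * d * Q u
  Q-hom d u = trans (cong (v *_) (norm-· d u)) (lemma v (d * d) (norm u))
    where
    lemma : ∀ v d x → v * (d * x) ≡ d * (v * x)
    lemma = solve-∀
  f-norm : ∀ z → norm (f z) ≡ v * v * extend o Q z
  f-norm z = begin
    norm (f z)
      ≡⟨ norm-apply M (apply H x ++ v · u) ⟩
    v * norm (apply H x ++ v · u)
      ≡⟨ cong (v *_) (dot-++ (apply H x) _ (v · u) _) ⟩
    v * (norm (apply H x) + norm (v · u))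
      ≡⟨ cong (v *_) (cong₂ _+_ (norm-apply H x) (norm-· v u)) ⟩
    v * (v * norm x + v * v * norm u)
      ≡⟨ lemma v (norm x) (norm u) ⟩
    v * v * (norm x + v * norm u) ∎
    where
    x = take o z
    u = drop o z
    lemma : ∀ v a b → v * (v * a + v * v * b) ≡ v * v * (a + v * b)
    lemma = solve-∀
  cancelled = cancel-norm o {Q} Q-hom v (λ ()) f F f-norm
  c = proj₁ cancelled
  c≢0 : c ≢ 0ℤ
  c≢0 = proj₁ (proj₂ cancelled)
  g = proj₁ (proj₂ (proj₂ cancelled))
  g-norm : ∀ z → norm (g z) ≡ c * c * Q z
  g-norm = proj₂ (proj₂ (proj₂ (proj₂ cancelled)))
  split : (w : Vec ℤ 2) → norm w ≡ c * c * (v * 1ℤ) → IsSumOfTwoSquares (v * (+ ∣ c ∣ * + ∣ c ∣))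
  split (a ∷ b ∷ []) w-norm = a , b , (begin
    v * (+ ∣ c ∣ * + ∣ c ∣)   ≡⟨ cong (v *_) (trans (sym (ℤ.pos-* ∣ c ∣ ∣ c ∣)) (square-∣∣ c)) ⟩
    v * (c * c)               ≡⟨ lemma v (c * c) ⟩
    c * c * (v * 1ℤ)          ≡⟨ sym w-norm ⟩
    a * a + (b * b + 0ℤ)      ≡⟨ cong (_+_ (a * a)) (ℤ.+-identityʳ (b * b)) ⟩
    a * a + b * b             ∎)
    where
    lemma : ∀ v c → v * c ≡ c * (v * 1ℤ)
    lemma = solve-∀

-- Matrices with orthogonal columns

δ : Fin n → Fin n → ℤ
δ zero zero = 1ℤ
δ zero (suc j) = 0ℤ
δ (suc i) zero = 0ℤ
δ (suc i) (suc j) = δ i j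

δ-refl : (i : Fin n) → δ i i ≡ 1ℤ
δ-refl zero = refl
δ-refl (suc i) = δ-refl i

δ-sym : (i j : Fin n) → δ i j ≡ δ j i
δ-sym zero zero = refl
δ-sym zero (suc j) = refl
δ-sym (suc i) zero = refl
δ-sym (suc i) (suc j) = δ-sym i j

δ-≢ : {i j : Fin n} → i ≢ j → δ i j ≡ 0ℤ
δ-≢ {i = zero} {zero} i≢j = contradiction refl i≢j
δ-≢ {i = zero} {suc j} i≢j = refl
δ-≢ {i = suc i} {zero} i≢j = refl
δ-≢ {i = suc i} {suc j} i≢j = δ-≢ (i≢j ∘ cong suc)

∑-zero : (f : Fin n → ℤ) → (∀ i → f i ≡ 0ℤ) → ∑[ i < n ] f i ≡ 0ℤ
∑-zero {n} f f≡0 = trans (sum-cong-≗ f≡0) (sum-replicate-zero n)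

∑-δ : (i : Fin n) (f : Fin n → ℤ) → ∑[ j < n ] (δ i j * f j) ≡ f i
∑-δ {suc n} zero f = begin
  1ℤ * f zero + ∑[ j < n ] (0ℤ * f (suc j))
    ≡⟨ cong₂ _+_ (ℤ.*-identityˡ (f zero)) (∑-zero (λ j → 0ℤ * f (suc j)) (λ j → ℤ.*-zeroˡ (f (suc j)))) ⟩
  f zero + 0ℤ
    ≡⟨ ℤ.+-identityʳ (f zero) ⟩
  f zero ∎
  where open ≡-Reasoning
∑-δ {suc n} (suc i) f = begin
  0ℤ * f zero + ∑[ j < n ] (δ i j * f (suc j))   ≡⟨ cong₂ _+_ (ℤ.*-zeroˡ (f zero)) (∑-δ i (f ∘ suc)) ⟩
  0ℤ + f (suc i)                                 ≡⟨ ℤ.+-identityˡ (f (suc i)) ⟩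
  f (suc i)                                      ∎
  where open ≡-Reasoning

∑-ones : ∀ n → ∑[ i < n ] 1ℤ ≡ + n
∑-ones zero = refl
∑-ones (suc n) = cong (_+_ 1ℤ) (∑-ones n)

∑-* : (f g : Fin n → ℤ) → sum f * sum g ≡ ∑[ i < n ] ∑[ j < n ] (f i * g j)
∑-* f g = trans (*-distribʳ-sum (sum g) f) (sum-cong-≗ λ i → *-distribˡ-sum (f i) g)

dot≡∑ : (x y : Vec ℤ n) → dot x y ≡ ∑[ i < n ] (lookup x i * lookup y i)
dot≡∑ [] [] = refl
dot≡∑ (a ∷ x) (b ∷ y) = cong (_+_ (a * b)) (dot≡∑ x y)

matrixVec : (Fin m → Fin n → ℤ) → Vec ℤ n → Vec ℤ m
matrixVec {n = n} M x = tabulate λ i → ∑[ j < n ] (M i j * lookup x j)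

tabulate-⊕ : (f g : Fin n → ℤ) → tabulate (λ i → f i + g i) ≡ tabulate f ⊕ tabulate g
tabulate-⊕ {zero} f g = refl
tabulate-⊕ {suc n} f g = cong (_∷_ (f zero + g zero)) (tabulate-⊕ (f ∘ suc) (g ∘ suc))

matrixVec-linear : (M : Fin m → Fin n → ℤ) → Linear (matrixVec M)
matrixVec-linear M .Linear.additive x y = trans (tabulate-cong λ i → begin
    sum (λ j → M i j * lookup (x ⊕ y) j)
      ≡⟨ sum-cong-≗ (λ j → trans (cong (M i j *_) (lookup-zipWith _+_ j x y))
           (ℤ.*-distribˡ-+ (M i j) (lookup x j) (lookup y j))) ⟩
    sum (λ j → M i j * lookup x j + M i j * lookup y j)
      ≡⟨ ∑-distrib-+ (λ j → M i j * lookup x j) (λ j → M i j * lookup y j) ⟩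
    sum (λ j → M i j * lookup x j) + sum (λ j → M i j * lookup y j) ∎)
  (tabulate-⊕ _ _)
  where open ≡-Reasoning
matrixVec-linear M .Linear.homogeneous c x = trans (tabulate-cong λ i → begin
    sum (λ j → M i j * lookup (c · x) j)
      ≡⟨ sum-cong-≗ (λ j → trans (cong (M i j *_) (lookup-map j (c *_) x)) (lemma (M i j) c (lookup x j))) ⟩
    sum (λ j → c * (M i j * lookup x j))
      ≡⟨ sym (*-distribˡ-sum c (λ j → M i j * lookup x j)) ⟩
    c * sum (λ j → M i j * lookup x j) ∎)
  (tabulate-∘ (c *_) _)
  where
  open ≡-Reasoning
  lemma : ∀ a c x → a * (c * x) ≡ c * (a * x)
  lemma = solve-∀

-- Expand the squared coordinates of M x and move the row sum innermost: it becomes an entry of Mᵀ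
-- M, and δ collapses the remaining double sum.
orthogonalColumns⇒similitude : (M : Fin n → Fin n → ℤ) (v : ℤ) →
  (∀ j k → ∑[ i < n ] (M i j * M i k) ≡ v * δ j k) → Similitude v n
orthogonalColumns⇒similitude {n} M v orth = record
  { apply = matrixVec M ; linear = matrixVec-linear M ; norm-apply = norm-eq }
  where
  open ≡-Reasoning
  regroup : ∀ a x b y → a * x * (b * y) ≡ x * y * (a * b)
  regroup = solve-∀
  regroup′ : ∀ x y v d → x * y * (v * d) ≡ d * (v * (x * y))
  regroup′ = solve-∀
  norm-eq : ∀ x → norm (matrixVec M x) ≡ v * norm x
  norm-eq x = begin
    norm (matrixVec M x)
      ≡⟨ dot≡∑ (matrixVec M x) (matrixVec M x) ⟩
    ∑[ i < n ] (lookup (matrixVec M x) i * lookup (matrixVec M x) i)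
      ≡⟨ sum-cong-≗ (λ i → cong (λ t → t * t) (lookup∘tabulate (λ i → ∑[ j < n ] (M i j * X j)) i)) ⟩
    ∑[ i < n ] (∑[ j < n ] (M i j * X j) * ∑[ k < n ] (M i k * X k))
      ≡⟨ sum-cong-≗ (λ i → ∑-* (λ j → M i j * X j) (λ k → M i k * X k)) ⟩
    ∑[ i < n ] ∑[ j < n ] ∑[ k < n ] (M i j * X j * (M i k * X k))
      ≡⟨ ∑-comm (λ i j → ∑[ k < n ] (M i j * X j * (M i k * X k))) ⟩
    ∑[ j < n ] ∑[ i < n ] ∑[ k < n ] (M i j * X j * (M i k * X k))
      ≡⟨ sum-cong-≗ (λ j → ∑-comm (λ i k → M i j * X j * (M i k * X k))) ⟩
    ∑[ j < n ] ∑[ k < n ] ∑[ i < n ] (M i j * X j * (M i k * X k))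
      ≡⟨ sum-cong-≗ (λ j → sum-cong-≗ (λ k → entry j k)) ⟩
    ∑[ j < n ] ∑[ k < n ] (δ j k * (v * (X j * X k)))
      ≡⟨ sum-cong-≗ (λ j → ∑-δ j (λ k → v * (X j * X k))) ⟩
    ∑[ j < n ] (v * (X j * X j))
      ≡⟨ sym (*-distribˡ-sum v (λ j → X j * X j)) ⟩
    v * ∑[ j < n ] (X j * X j)
      ≡⟨ cong (v *_) (sym (dot≡∑ x x)) ⟩
    v * norm x ∎
    where
    X = lookup x
    entry : ∀ j k → ∑[ i < n ] (M i j * X j * (M i k * X k)) ≡ δ j k * (v * (X j * X k))
    entry j k = begin
      ∑[ i < n ] (M i j * X j * (M i k * X k))   ≡⟨ sum-cong-≗ (λ i → regroup (M i j) (X j) (M i k) (X k)) ⟩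
      ∑[ i < n ] (X j * X k * (M i j * M i k))   ≡⟨ sym (*-distribˡ-sum (X j * X k) (λ i → M i j * M i k)) ⟩
      X j * X k * ∑[ i < n ] (M i j * M i k)     ≡⟨ cong (X j * X k *_) (orth j k) ⟩
      X j * X k * (v * δ j k)                    ≡⟨ regroup′ (X j) (X k) v (δ j k) ⟩
      δ j k * (v * (X j * X k))                  ∎

-- When S is a symmetric Seidel matrix with S Sᵀ = nI - J and zero row sums, this is a symmetric
-- conference matrix.
bordered : (Fin n → Fin n → ℤ) → Fin (suc n) → Fin (suc n) → ℤ
bordered S zero zero = 0ℤ
bordered S zero (suc j) = 1ℤ
bordered S (suc i) zero = 1ℤ
bordered S (suc i) (suc j) = S i j

-- The border adds 1 to every inner product of two columns of S, which turns nI - J into nI. Zero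
-- column sums make these columns orthogonal to the border column.
bordered-similitude : (S : Fin n → Fin n → ℤ) → (∀ j → ∑[ i < n ] S i j ≡ 0ℤ) →
  (∀ j k → ∑[ i < n ] (S i j * S i k) ≡ + n * δ j k - 1ℤ) → Similitude (+ n) (suc n)
bordered-similitude {n} S colSum gram = orthogonalColumns⇒similitude (bordered S) (+ n) orth
  where
  B = bordered S
  orth : ∀ j k → ∑[ i < suc n ] (B i j * B i k) ≡ + n * δ j k
  orth zero zero = trans (ℤ.+-identityˡ _) (trans (∑-ones n) (sym (ℤ.*-identityʳ (+ n))))
  orth zero (suc k) = trans (ℤ.+-identityˡ _)
    (trans (sum-cong-≗ (λ i → ℤ.*-identityˡ (S i k))) (trans (colSum k) (sym (ℤ.*-zeroʳ (+ n)))))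
  orth (suc j) zero = trans (ℤ.+-identityˡ _)
    (trans (sum-cong-≗ (λ i → ℤ.*-identityʳ (S i j))) (trans (colSum j) (sym (ℤ.*-zeroʳ (+ n)))))
  orth (suc j) (suc k) = trans (cong (_+_ 1ℤ) (gram j k)) (lemma (+ n * δ j k))
    where
    lemma : ∀ a → 1ℤ + (a - 1ℤ) ≡ a
    lemma = solve-∀

-- Self-complementary strongly regular graphs

⟦_⟧ : Bool → ℤ
⟦ true ⟧ = 1ℤ
⟦ false ⟧ = 0ℤ

⟦∧⟧ : ∀ a b → ⟦ a ∧ b ⟧ ≡ ⟦ a ⟧ * ⟦ b ⟧
⟦∧⟧ true b = sym (ℤ.*-identityˡ ⟦ b ⟧)
⟦∧⟧ false b = refl

count≡∑ : (p : Fin n → Bool) → + count p ≡ ∑[ i < n ] ⟦ p i ⟧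
count≡∑ p = go p (λ i → i)
  where
  -- `allFin` is `tabulate` of the identity, and the tail of that list tabulates `suc`; the
  -- induction therefore runs over an arbitrary tabulated function.
  go : ∀ {A : Set} (p : A → Bool) (f : Fin m → A) →
    + List.length (List.filter (λ w → Bool.T? (p w)) (List.tabulate f)) ≡ ∑[ i < m ] ⟦ p (f i) ⟧
  go {zero} p f = refl
  go {suc m} p f with p (f zero)
  ... | true = cong (_+_ 1ℤ) (go p (f ∘ suc))
  ... | false = trans (go p (f ∘ suc)) (sym (ℤ.+-identityˡ _))

count-false : (p : Fin n → Bool) → (∀ i → p i ≡ false) → count p ≡ 0
count-false p p≡false = ℤ.+-injective (trans (count≡∑ p) (∑-zero _ (λ i → cong ⟦_⟧ (p≡false i))))

count-witness : (p : Fin n → Bool) → count p ≢ 0 → Σ (Fin n) λ i → p i ≡ true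
count-witness p nonzero with any? (λ i → p i Bool.≟ true)
... | yes witness = witness
... | no none = contradiction (count-false p (λ i → Bool.¬-not (λ eq → none (i , eq)))) nonzero

count≢0 : (p : Fin n → Bool) (i : Fin n) → p i ≡ true → count p ≢ 0
count≢0 p i pi = ℕ.m<n⇒n≢0 (∈-length (∈-filter⁺ (λ w → Bool.T? (p w)) (∈-allFin i) (Equivalence.from Bool.T-≡ pi)))

module SelfComplementarySRG {n k lam mu : ℕ} (G : Graph n) (srg : IsSRG G k lam mu)
    (selfCompl : SelfComplementary G) where
  open IsSRG srg
  open ≡-Reasoning

  σ : Fin n ↔ Fin n
  σ = proj₁ selfCompl

  to : Fin n → Fin n
  to = Inverse.to σ

  to-injective : ∀ {u v} → to u ≡ to v → u ≡ v
  to-injective = Injection.injective (↔⇒↣ σ)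

  -- `A` is the adjacency matrix and `S` = J - I - 2A the Seidel matrix: 0 on the diagonal, -1 on
  -- edges, 1 on non-edges.
  A S : Fin n → Fin n → ℤ
  A u v = ⟦ adj G u v ⟧
  S u v = 1ℤ - δ u v - (A u v + A u v)

  A-sym : ∀ u v → A u v ≡ A v u
  A-sym u v = cong ⟦_⟧ (Graph.sym G u v)

  S-sym : ∀ u v → S u v ≡ S v u
  S-sym u v = cong₂ (λ d a → 1ℤ - d - (a + a)) (δ-sym u v) (A-sym u v)

  S-diagonal : ∀ u → S u u ≡ 0ℤ
  S-diagonal u = cong₂ (λ d a → 1ℤ - d - (a + a)) (δ-refl u) (cong ⟦_⟧ (irrefl G u))

  S-adjacent : ∀ {u v} → u ≢ v → adj G u v ≡ true → S u v ≡ -1ℤ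
  S-adjacent u≢v uv = cong₂ (λ d a → 1ℤ - d - (a + a)) (δ-≢ u≢v) (cong ⟦_⟧ uv)

  S-nonadjacent : ∀ {u v} → u ≢ v → adj G u v ≡ false → S u v ≡ 1ℤ
  S-nonadjacent u≢v uv = cong₂ (λ d a → 1ℤ - d - (a + a)) (δ-≢ u≢v) (cong ⟦_⟧ uv)

  adjacent⇒≢ : ∀ {u v} → adj G u v ≡ true → u ≢ v
  adjacent⇒≢ {u} uv refl = contradiction (trans (sym uv) (irrefl G u)) (λ ())

  -- The permutation exchanges edges with non-edges, hence -1 with 1, and keeps the zero diagonal.
  S-to : ∀ u v → S (to u) (to v) ≡ - S u v
  S-to u v with u ≟ v
  ... | yes refl = trans (S-diagonal (to u)) (cong -_ (sym (S-diagonal u)))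
  ... | no u≢v with adj G u v in uv
  ...   | true = trans (S-nonadjacent (u≢v ∘ to-injective) (Bool.¬-not λ eq →
                   contradiction (trans (sym uv) (proj₂ (Equivalence.to (proj₂ selfCompl u v) eq))) (λ ())))
                 (cong -_ (sym (cong (λ d → 1ℤ - d - (1ℤ + 1ℤ)) (δ-≢ u≢v))))
  ...   | false = trans (S-adjacent (u≢v ∘ to-injective) (Equivalence.from (proj₂ selfCompl u v) (u≢v , uv)))
                 (cong -_ (sym (cong (λ d → 1ℤ - d - 0ℤ) (δ-≢ u≢v))))

  -- The action of J - I - 2A on a vector. It serves with the all-ones vector for row sums and with
  -- rows of `S` and `A` for Gram entries.
  ∑-S : ∀ v (f : Fin n → ℤ) →
    ∑[ w < n ] (S v w * f w) ≡ sum f - f v - (∑[ w < n ] (A v w * f w) + ∑[ w < n ] (A v w * f w))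
  ∑-S v f = begin
    ∑[ w < n ] (S v w * f w)
      ≡⟨ sum-cong-≗ (λ w → expand (δ v w) (A v w) (f w)) ⟩
    ∑[ w < n ] (f w + (-1ℤ * (δ v w * f w) + - (+ 2) * (A v w * f w)))
      ≡⟨ ∑-distrib-+ f _ ⟩
    sum f + ∑[ w < n ] (-1ℤ * (δ v w * f w) + - (+ 2) * (A v w * f w))
      ≡⟨ cong (_+_ (sum f)) (∑-distrib-+ (λ w → -1ℤ * (δ v w * f w)) _) ⟩
    sum f + (∑[ w < n ] (-1ℤ * (δ v w * f w)) + ∑[ w < n ] (- (+ 2) * (A v w * f w)))
      ≡⟨ cong (_+_ (sum f)) (cong₂ _+_
           (trans (sym (*-distribˡ-sum -1ℤ (λ w → δ v w * f w))) (cong (-1ℤ *_) (∑-δ v f)))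
           (sym (*-distribˡ-sum (- (+ 2)) (λ w → A v w * f w)))) ⟩
    sum f + (-1ℤ * f v + - (+ 2) * ∑[ w < n ] (A v w * f w))
      ≡⟨ collect (sum f) (f v) (∑[ w < n ] (A v w * f w)) ⟩
    sum f - f v - (∑[ w < n ] (A v w * f w) + ∑[ w < n ] (A v w * f w)) ∎
    where
    expand : ∀ d a x → (1ℤ - d - (a + a)) * x ≡ x + (-1ℤ * (d * x) + - (+ 2) * (a * x))
    expand = solve-∀
    collect : ∀ s x y → s + (-1ℤ * x + - (+ 2) * y) ≡ s - x - (y + y)
    collect = solve-∀

  ∑-A : ∀ u → sum (A u) ≡ + k
  ∑-A u = trans (sym (count≡∑ (adj G u))) (cong +_ (regular u))

  ∑-AA : ∀ u v → ∑[ w < n ] (A u w * A v w) ≡ + commonNbrs G u v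
  ∑-AA u v = sym (trans (count≡∑ (λ w → adj G u w ∧ adj G v w))
                        (sum-cong-≗ (λ w → ⟦∧⟧ (adj G u w) (adj G v w))))

  ∑-S-value : ∀ u → sum (S u) ≡ + n - 1ℤ - (+ k + + k)
  ∑-S-value u = begin
    sum (S u)                                     ≡⟨ sum-cong-≗ (λ w → sym (ℤ.*-identityʳ (S u w))) ⟩
    ∑[ w < n ] (S u w * 1ℤ)                       ≡⟨ ∑-S u (λ _ → 1ℤ) ⟩
    ∑[ w < n ] 1ℤ - 1ℤ - (∑[ w < n ] (A u w * 1ℤ) + ∑[ w < n ] (A u w * 1ℤ))
      ≡⟨ cong₂ (λ x y → x - 1ℤ - (y + y)) (∑-ones n)
           (trans (sum-cong-≗ (λ w → ℤ.*-identityʳ (A u w))) (∑-A u)) ⟩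
    + n - 1ℤ - (+ k + + k)                        ∎

  -- By regularity all row sums agree. Reindexing the row of `to u` along the permutation gives the
  -- negated row of `u`, so the common value equals its own negative.
  ∑-S-zero : ∀ u → sum (S u) ≡ 0ℤ
  ∑-S-zero u = x≡-x⇒x≡0 (sum (S u)) (begin
    sum (S u)                        ≡⟨ trans (∑-S-value u) (sym (∑-S-value (to u))) ⟩
    sum (S (to u))                   ≡⟨ sum-permute (S (to u)) σ ⟩
    ∑[ w < n ] S (to u) (to w)       ≡⟨ sum-cong-≗ (λ w → trans (S-to u w) (sym (ℤ.-1*i≡-i (S u w)))) ⟩
    ∑[ w < n ] (-1ℤ * S u w)         ≡⟨ sym (*-distribˡ-sum -1ℤ (S u)) ⟩
    -1ℤ * sum (S u)                  ≡⟨ ℤ.-1*i≡-i (sum (S u)) ⟩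
    - sum (S u)                      ∎)

  u₀ = proj₁ notEdgeless

  n≡1+2k : + n ≡ 1ℤ + (+ k + + k)
  n≡1+2k = trans (rearrange (+ n) (+ k))
    (cong (_+ (1ℤ + (+ k + + k))) (trans (sym (∑-S-value u₀)) (∑-S-zero u₀)))
    where
    rearrange : ∀ n k → n ≡ n - 1ℤ - (k + k) + (1ℤ + (k + k))
    rearrange = solve-∀

  -- Gram matrix of the Seidel matrix

  gram : Fin n → Fin n → ℤ
  gram u v = ∑[ w < n ] (S u w * S v w)

  -- Expand the two factors of S Sᵀ in turn by `∑-S`. Zero row sums remove the J-term of the first
  -- expansion, and `x` is the entry of A S left by the second.
  gram-value : ∀ u v → let x = + k - A v u - (+ commonNbrs G u v + + commonNbrs G u v) in
    gram u v ≡ - S v u - (x + x)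
  gram-value u v = begin
    gram u v
      ≡⟨ ∑-S u (S v) ⟩
    sum (S v) - S v u - (∑[ w < n ] (A u w * S v w) + ∑[ w < n ] (A u w * S v w))
      ≡⟨ cong₂ (λ x y → x - S v u - (y + y)) (∑-S-zero v) (begin
           ∑[ w < n ] (A u w * S v w)
             ≡⟨ sum-cong-≗ (λ w → ℤ.*-comm (A u w) (S v w)) ⟩
           ∑[ w < n ] (S v w * A u w)
             ≡⟨ ∑-S v (A u) ⟩
           sum (A u) - A u v - (∑[ w < n ] (A v w * A u w) + ∑[ w < n ] (A v w * A u w))
             ≡⟨ cong₂ (λ x y → x - A u v - (y + y)) (∑-A u)
                  (trans (sum-cong-≗ (λ w → ℤ.*-comm (A v w) (A u w))) (∑-AA u v)) ⟩
           + k - A u v - (+ commonNbrs G u v + + commonNbrs G u v)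
             ≡⟨ cong (λ a → + k - a - (+ commonNbrs G u v + + commonNbrs G u v)) (A-sym u v) ⟩
           x ∎) ⟩
    0ℤ - S v u - (x + x)
      ≡⟨ cong (_- (x + x)) (ℤ.+-identityˡ (- S v u)) ⟩
    - S v u - (x + x) ∎
    where x = + k - A v u - (+ commonNbrs G u v + + commonNbrs G u v)

  gram-adjacent : ∀ {u v} → adj G u v ≡ true → let x = + k - 1ℤ - (+ lam + + lam) in
    gram u v ≡ 1ℤ - (x + x)
  gram-adjacent {u} {v} uv = begin
    gram u v                              ≡⟨ gram-value u v ⟩
    - S v u - (y + y)
      ≡⟨ cong₂ (λ s x → - s - (x + x)) (S-adjacent (adjacent⇒≢ vu) vu)
           (cong₂ (λ a c → + k - a - (+ c + + c)) (cong ⟦_⟧ vu) (adjCommon u v uv)) ⟩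
    1ℤ - (x + x)                          ∎
    where
    vu = trans (Graph.sym G v u) uv
    x = + k - 1ℤ - (+ lam + + lam)
    y = + k - A v u - (+ commonNbrs G u v + + commonNbrs G u v)

  gram-nonadjacent : ∀ {u v} → u ≢ v → adj G u v ≡ false → let x = + k - 0ℤ - (+ mu + + mu) in
    gram u v ≡ -1ℤ - (x + x)
  gram-nonadjacent {u} {v} u≢v uv = begin
    gram u v                              ≡⟨ gram-value u v ⟩
    - S v u - (y + y)
      ≡⟨ cong₂ (λ s x → - s - (x + x)) (S-nonadjacent (u≢v ∘ sym) vu)
           (cong₂ (λ a c → + k - a - (+ c + + c)) (cong ⟦_⟧ vu) (nonCommon u v u≢v uv)) ⟩
    -1ℤ - (x + x)                         ∎
    where
    vu = trans (Graph.sym G v u) uv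
    x = + k - 0ℤ - (+ mu + + mu)
    y = + k - A v u - (+ commonNbrs G u v + + commonNbrs G u v)

  gram-diagonal : ∀ u → gram u u ≡ + k + + k
  gram-diagonal u = begin
    gram u u                              ≡⟨ gram-value u u ⟩
    - S u u - (y + y)
      ≡⟨ cong₂ (λ s x → - s - (x + x)) (S-diagonal u)
           (cong₂ (λ a c → + k - a - (c + c)) (cong ⟦_⟧ (irrefl G u)) common) ⟩
    - 0ℤ - (x + x)                        ≡⟨ simplify (+ k) ⟩
    + k + + k                             ∎
    where
    x = + k - 0ℤ - (+ k + + k)
    y = + k - A u u - (+ commonNbrs G u u + + commonNbrs G u u)
    common : + commonNbrs G u u ≡ + k
    common = trans (sym (∑-AA u u)) (trans (sum-cong-≗ (λ w → trans (sym (⟦∧⟧ (adj G u w) (adj G u w)))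
      (cong ⟦_⟧ (Bool.∧-idem (adj G u w))))) (∑-A u))
    simplify : ∀ k → - 0ℤ - (k - 0ℤ - (k + k) + (k - 0ℤ - (k + k))) ≡ k + k
    simplify = solve-∀

  -- Both factors change sign under the permutation, so their products do not. This is what ties the
  -- value on edges to the value on non-edges.
  gram-to : ∀ u v → gram (to u) (to v) ≡ gram u v
  gram-to u v = begin
    gram (to u) (to v)
      ≡⟨ sum-permute (λ w → S (to u) w * S (to v) w) σ ⟩
    ∑[ w < n ] (S (to u) (to w) * S (to v) (to w))
      ≡⟨ sum-cong-≗ (λ w → trans (cong₂ _*_ (S-to u w) (S-to v w)) (signs (S u w) (S v w))) ⟩
    gram u v ∎
    where
    signs : ∀ a b → - a * - b ≡ a * b
    signs = solve-∀

  -- The value -1 - 2(k - 2μ) of `gram-nonadjacent`; `lam-value` shows that edges share it.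
  offDiagonal : ℤ
  offDiagonal = -1ℤ - (+ k - 0ℤ - (+ mu + + mu) + (+ k - 0ℤ - (+ mu + + mu)))

  -- The permutation carries a non-adjacent pair, which exists since the graph is not complete, to
  -- an edge with the same Gram entry.
  lam-value : 1ℤ - (+ k - 1ℤ - (+ lam + + lam) + (+ k - 1ℤ - (+ lam + + lam))) ≡ offDiagonal
  lam-value with notComplete
  ... | u , v , u≢v , uv = begin
    _                     ≡⟨ sym (gram-adjacent (Equivalence.from (proj₂ selfCompl u v) (u≢v , uv))) ⟩
    gram (to u) (to v)    ≡⟨ gram-to u v ⟩
    gram u v              ≡⟨ gram-nonadjacent u≢v uv ⟩
    offDiagonal           ∎

  gram-≢ : ∀ {u v} → u ≢ v → gram u v ≡ offDiagonal
  gram-≢ {u} {v} u≢v with adj G u v in uv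
  ... | true = trans (gram-adjacent uv) lam-value
  ... | false = gram-nonadjacent u≢v uv

  -- The form oJ + (2k - o)I, whose row sums can be evaluated at once.
  gram-δ : ∀ u v → gram u v ≡ offDiagonal + δ u v * (+ k + + k - offDiagonal)
  gram-δ u v with u ≟ v
  ... | yes refl = trans (gram-diagonal u) (trans (lemma (+ k + + k) offDiagonal)
                     (cong (λ d → offDiagonal + d * (+ k + + k - offDiagonal)) (sym (δ-refl u))))
    where
    lemma : ∀ a b → a ≡ b + 1ℤ * (a - b)
    lemma = solve-∀
  ... | no u≢v = trans (gram-≢ u≢v) (trans (lemma (+ k + + k) offDiagonal)
                     (cong (λ d → offDiagonal + d * (+ k + + k - offDiagonal)) (sym (δ-≢ u≢v))))
    where
    lemma : ∀ a b → b ≡ b + 0ℤ * (a - b)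
    lemma = solve-∀

  -- S S annihilates the all-ones vector because S does.
  ∑-gram : ∀ u → ∑[ v < n ] gram u v ≡ 0ℤ
  ∑-gram u = begin
    ∑[ v < n ] ∑[ w < n ] (S u w * S v w)   ≡⟨ ∑-comm (λ v w → S u w * S v w) ⟩
    ∑[ w < n ] ∑[ v < n ] (S u w * S v w)   ≡⟨ ∑-zero _ (λ w → begin
      ∑[ v < n ] (S u w * S v w)   ≡⟨ sym (*-distribˡ-sum (S u w) (λ v → S v w)) ⟩
      S u w * ∑[ v < n ] S v w     ≡⟨ cong (S u w *_) (trans (sum-cong-≗ (λ v → S-sym v w)) (∑-S-zero w)) ⟩
      S u w * 0ℤ                   ≡⟨ ℤ.*-zeroʳ (S u w) ⟩
      0ℤ                           ∎) ⟩
    0ℤ                                      ∎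

  k≢0 : k ≢ 0
  k≢0 k≡0 = count≢0 (adj G u₀) (proj₁ (proj₂ notEdgeless)) (proj₂ (proj₂ notEdgeless)) (trans (regular u₀) k≡0)

  -- The rows of the Gram matrix sum to 2k + (n − 1)·offDiagonal = 2k (1 + offDiagonal).
  offDiagonal≡-1 : offDiagonal ≡ -1ℤ
  offDiagonal≡-1 = ℤ.*-cancelˡ-≡ (+ k) offDiagonal -1ℤ {{ℕ.≢-nonZero k≢0}} (halve (+ k) o (begin
    + k * (o + 1ℤ) + + k * (o + 1ℤ)
      ≡⟨ regroup (+ k) o ⟩
    (1ℤ + (+ k + + k)) * o + (+ k + + k - o)
      ≡⟨ cong (λ t → t * o + (+ k + + k - o)) (sym n≡1+2k) ⟩
    + n * o + (+ k + + k - o)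
      ≡⟨ cong (λ t → t * o + (+ k + + k - o)) (sym (∑-ones n)) ⟩
    ∑[ v < n ] 1ℤ * o + (+ k + + k - o)
      ≡⟨ cong₂ _+_ (*-distribʳ-sum o (λ (_ : Fin n) → 1ℤ)) (sym (∑-δ u₀ (λ _ → + k + + k - o))) ⟩
    ∑[ v < n ] (1ℤ * o) + ∑[ v < n ] (δ u₀ v * (+ k + + k - o))
      ≡⟨ sym (∑-distrib-+ (λ _ → 1ℤ * o) (λ v → δ u₀ v * (+ k + + k - o))) ⟩
    ∑[ v < n ] (1ℤ * o + δ u₀ v * (+ k + + k - o))
      ≡⟨ sum-cong-≗ (λ v → trans (cong (_+ δ u₀ v * (+ k + + k - o)) (ℤ.*-identityˡ o)) (sym (gram-δ u₀ v))) ⟩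
    ∑[ v < n ] gram u₀ v
      ≡⟨ ∑-gram u₀ ⟩
    0ℤ ∎))
    where
    o = offDiagonal
    regroup : ∀ k o → k * (o + 1ℤ) + k * (o + 1ℤ) ≡ (1ℤ + (k + k)) * o + (k + k - o)
    regroup = solve-∀
    expand : ∀ k o → k * o ≡ k * (o + 1ℤ) + k * -1ℤ
    expand = solve-∀
    halve : ∀ k o → k * (o + 1ℤ) + k * (o + 1ℤ) ≡ 0ℤ → k * o ≡ k * -1ℤ
    halve k o eq = trans (expand k o) (trans (cong (_+ k * -1ℤ) (double≡0 (k * (o + 1ℤ)) eq)) (ℤ.+-identityˡ _))

  -- The value -1 - 2(k - 2μ) equals -1 only when k = 2μ.
  k≡2mu : k ≡ 2 ℕ.* mu
  k≡2mu = ℤ.+-injective (begin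
    + k                        ≡⟨ ℤ.i-j≡0⇒i≡j (+ k) (+ mu + + mu) (double≡0 _ (begin
      k-2mu + k-2mu              ≡⟨ isolate (+ k) (+ mu) ⟩
      -1ℤ - offDiagonal          ≡⟨ cong (_-_ -1ℤ) offDiagonal≡-1 ⟩
      0ℤ                         ∎)) ⟩
    + mu + + mu                ≡⟨ cong (λ x → + (mu ℕ.+ x)) (sym (ℕ.+-identityʳ mu)) ⟩
    + (2 ℕ.* mu)               ∎)
    where
    k-2mu = + k - (+ mu + + mu)
    isolate : ∀ k m → k - (m + m) + (k - (m + m)) ≡ -1ℤ - (-1ℤ - (k - 0ℤ - (m + m) + (k - 0ℤ - (m + m))))
    isolate = solve-∀

  -- `lam-value` reads 3 + 4λ - 2k = -1 + 4μ - 2k; adding 1 + 2k to both sides gives 4(1 + λ) = 4μ.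
  1+lam≡mu : 1 ℕ.+ lam ≡ mu
  1+lam≡mu = ℤ.+-injective (ℤ.*-cancelˡ-≡ (+ 4) (1ℤ + + lam) (+ mu)
    (trans (left (+ k) (+ lam)) (trans (cong (λ x → x + + 1 + + k + + k) lam-value) (right (+ k) (+ mu)))))
    where
    left : ∀ k l → + 4 * (1ℤ + l) ≡ 1ℤ - (k - 1ℤ - (l + l) + (k - 1ℤ - (l + l))) + + 1 + k + k
    left = solve-∀
    right : ∀ k m → -1ℤ - (k - 0ℤ - (m + m) + (k - 0ℤ - (m + m))) + + 1 + k + k ≡ + 4 * m
    right = solve-∀

  n≡4mu+1 : n ≡ 4 ℕ.* mu ℕ.+ 1
  n≡4mu+1 = trans (ℤ.+-injective n≡1+2k) (trans (cong (λ x → 1 ℕ.+ (x ℕ.+ x)) k≡2mu) (lemma mu))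
    where
    lemma : ∀ m → 1 ℕ.+ (2 ℕ.* m ℕ.+ 2 ℕ.* m) ≡ 4 ℕ.* m ℕ.+ 1
    lemma = ℕ-Ring.solve-∀

  gram≡nI-J : ∀ u v → gram u v ≡ + n * δ u v - 1ℤ
  gram≡nI-J u v = begin
    gram u v                                                 ≡⟨ gram-δ u v ⟩
    offDiagonal + δ u v * (+ k + + k - offDiagonal)          ≡⟨ cong (λ o → o + δ u v * (+ k + + k - o)) offDiagonal≡-1 ⟩
    -1ℤ + δ u v * (+ k + + k - -1ℤ)                          ≡⟨ lemma (+ k) (δ u v) ⟩
    (1ℤ + (+ k + + k)) * δ u v - 1ℤ                          ≡⟨ cong (λ x → x * δ u v - 1ℤ) (sym n≡1+2k) ⟩
    + n * δ u v - 1ℤ                                         ∎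
    where
    lemma : ∀ k d → -1ℤ + d * (k + k - -1ℤ) ≡ (1ℤ + (k + k)) * d - 1ℤ
    lemma = solve-∀

  -- The bordered matrix has order n + 1 = 4μ + 2 = 2(1 + 2μ), twice an odd number.
  n-sumOfTwoSquares : IsSumOfTwoSquares (+ n)
  n-sumOfTwoSquares = similitude⇒sumOfTwoSquares n mu
    {{ℕ.≢-nonZero (λ n≡0 → ℕ.m+1+n≢0 (4 ℕ.* mu) (trans (sym n≡4mu+1) n≡0))}}
    (subst (Similitude (+ n)) (trans (cong suc n≡4mu+1) (lemma mu))
      (bordered-similitude S
        (λ j → trans (sum-cong-≗ (λ i → S-sym i j)) (∑-S-zero j))
        (λ j k → trans (sum-cong-≗ (λ i → cong₂ _*_ (S-sym i j) (S-sym i k))) (gram≡nI-J j k))))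
    where
    lemma : ∀ m → 1 ℕ.+ (4 ℕ.* m ℕ.+ 1) ≡ 2 ℕ.* (1 ℕ.+ 2 ℕ.* m)
    lemma = ℕ-Ring.solve-∀

-- Distance two and the complement

commonNeighbour : (G : Graph n) → ∀ {u v w} → adj G u w ≡ true → adj G w v ≡ true → commonNbrs G u v ≢ 0
commonNeighbour G {u} {v} {w} uw wv = count≢0 (λ w → adj G u w ∧ adj G v w) w
  (cong₂ _∧_ uw (trans (Graph.sym G v w) wv))

-- An edge pulled back along the isomorphism is a pair at distance 2: non-adjacent, yet with a
-- common neighbour.
mu≢0 : ∀ {k lam mu} (G : Graph n) → IsSRG G k lam mu → Dist2IsoSelf G → mu ≢ 0
mu≢0 G srg (σ , iso) refl with IsSRG.notEdgeless srg
... | u , v , uv with Equivalence.to (iso (Inverse.from σ u) (Inverse.from σ v))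
                        (trans (cong₂ (adj G) (Inverse.strictlyInverseˡ σ u) (Inverse.strictlyInverseˡ σ v)) uv)
...   | u≢v , nonadj , w , uw , wv = commonNeighbour G uw wv (IsSRG.nonCommon srg _ _ u≢v nonadj)

-- Since μ > 0, distinct non-adjacent vertices always have a common neighbour. Distance 2 is then
-- the same as non-adjacency, and the same permutation serves.
dist2Iso⇒selfComplementary : ∀ {k lam mu} (G : Graph n) → IsSRG G k lam mu → Dist2IsoSelf G → SelfComplementary G
dist2Iso⇒selfComplementary G srg (σ , iso) = σ , λ u v → mk⇔
  (λ eq → let u≢v , nonadj , _ = Equivalence.to (iso u v) eq in u≢v , nonadj)
  (λ (u≢v , nonadj) → Equivalence.from (iso u v) (u≢v , nonadj , path u v u≢v nonadj))
  where
  path : ∀ u v → u ≢ v → adj G u v ≡ false → Σ _ λ w → adj G u w ≡ true × adj G w v ≡ true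
  path u v u≢v nonadj with count-witness (λ w → adj G u w ∧ adj G v w)
    (λ none → mu≢0 G srg (σ , iso) (trans (sym (IsSRG.nonCommon srg u v u≢v nonadj)) none))
  ... | w , both = w , Bool.∧-conicalˡ _ _ both , trans (Graph.sym G w v) (Bool.∧-conicalʳ (adj G u w) _ both)

theorem6p2 : (n k lam mu : ℕ) (G : Graph n) → IsSRG G k lam mu → Dist2IsoSelf G →
    SelfComplementary G ×
    Σ ℕ (λ t → (1 ℕ.≤ t) × (n ≡ 4 ℕ.* t ℕ.+ 1) × (k ≡ 2 ℕ.* t) × (lam ≡ t ℕ.∸ 1) × (mu ≡ t) ×
    Σ ℕ (λ a → Σ ℕ (λ b → 4 ℕ.* t ℕ.+ 1 ≡ a ℕ.* a ℕ.+ b ℕ.* b)))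
theorem6p2 n k lam mu G srg iso =
  -- The witness for t is μ. The truncated subtraction in t ∸ 1 is exact, as it comes from 1 + λ =
  -- μ.
  selfCompl , mu , ℕ.n≢0⇒n>0 (mu≢0 G srg iso) , n≡4mu+1 , k≡2mu , cong (ℕ._∸ 1) 1+lam≡mu , refl ,
  ∣ a ∣ , ∣ b ∣ , trans (sym n≡4mu+1) (ℤ.+-injective (trans n≡a²+b² (sym (cong₂ _+_ (square-∣∣ a) (square-∣∣ b)))))
  where
  selfCompl = dist2Iso⇒selfComplementary G srg iso
  open SelfComplementarySRG G srg selfCompl
  a = proj₁ n-sumOfTwoSquares
  b = proj₁ (proj₂ n-sumOfTwoSquares)
  n≡a²+b² = proj₂ (proj₂ n-sumOfTwoSquares)
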